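{- Let $A$ be a prime with $A\equiv 3\pmod 8$, and write $A=a^2+2b^2$ with positive integers $a,b$. Then there exist nonnegative integers $l,m$ satisfying $$b\,|l^2-2m^2|-2alm=\pm 1$$ (for one of the two signs) such that the minimal natural solution $x$ of Pell's equation $y^2-Ax^2=1$ is $$x=\bigl|\,4blm+a\,|l^2-2m^2|\,\bigr|\cdot(l^2+2m^2).$$
   Context: For a positive integer $A$ that is not a perfect square, the minimal natural solution of Pell's equation $y^2-Ax^2=1$ is the smallest positive integer $x$ for which there is a positive integer $y$ with $y^2-Ax^2=1$ (the trivial solution $(x,y)=(0,1)$ is excluded). -}

module Defs where

open import Data.Nat using (ℕ; _+_; _*_; _<_; _≤_)
open import Data.Product using (Σ; ∃; _×_)
open import Data.Integer as ℤ using (ℤ; +_; ∣_∣)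

-- (x , y) is a solution of Pell's equation y² - A x² = 1 in natural numbers,
-- written additively: y² = A x² + 1.
PellSolution : ℕ → ℕ → ℕ → Set
PellSolution A x y = y * y ≡ A * (x * x) + 1
  where open import Relation.Binary.PropositionalEquality using (_≡_)

-- x is the minimal natural solution of y² - A x² = 1:
-- the smallest positive x for which some positive y satisfies the equation.
IsMinimalPellSolution : ℕ → ℕ → Set
IsMinimalPellSolution A x =
  (0 < x × ∃ λ y → 0 < y × PellSolution A x y)
  × (∀ x' y' → 0 < x' → 0 < y' → PellSolution A x' y' → x ≤ x')

-- |l² - 2m²| as a natural number
absDiff : ℕ → ℕ → ℕ
absDiff l m = ∣ (+ (l * l)) ℤ.- (+ (2 * (m * m))) ∣

{-# OPTIONS --safe #-}
module Submission where

-- A solution exists because √A has infinitely many approximants y/q with 0 < |y² − A q²| ≤ 2A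
-- (Dirichlet); two of them with the same norm N that are congruent modulo |N| compose, by
-- Brahmagupta's identity, to a nontrivial solution.
--
-- For the minimal solution (x, y), y is even: if y = 2j + 1 then j (j + 1) = A (x/2)², so either
-- j = A s² and j + 1 = t² is a smaller solution, or s² + 1 = A t², impossible modulo 8. Hence the
-- coprime numbers y − 1 and y + 1 are u² and A v² (A s² + 2 = t² being impossible modulo 8), and
-- x = u v with u² + 2 = A v². In ℤ[√−2] the prime A = (a + b√−2)(a − b√−2) divides
-- (u + √−2)(u − √−2); the cofactor C ± E√−2 has norm C² + 2E² = v², gives u = aC + 2bE and
-- bC − aE = ±1, and the coprime solutions of C² + 2E² = v² are C = |l² − 2m²|, E = 2lm, v = l² + 2m².

module SquareFactors where

  open import Data.Nat
  open import Data.Nat.Properties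
  open import Data.Nat.Divisibility
  open import Data.Nat.Coprimality as Coprime using (Coprime; coprime-divisor; coprime⇒gcd≡1; coprime-/gcd)
  open import Data.Nat.GCD
  open import Data.Nat.DivMod using (m/n*n≡m)
  open import Data.Nat.Induction using (<-rec)
  open import Data.Nat.Primality using (Prime; euclidsLemma; prime⇒nonZero; prime⇒nonTrivial)
  open import Data.Product
  open import Data.Sum
  open import Function using (id)
  open import Relation.Binary.PropositionalEquality
  open import Data.Nat.Tactic.RingSolver

  m*m≤n*n⇒m≤n : ∀ {m n} → m * m ≤ n * n → m ≤ n
  m*m≤n*n⇒m≤n m²≤n² = ≮⇒≥ λ n<m → <⇒≱ (*-mono-< n<m n<m) m²≤n²

  m*m<n*n⇒m<n : ∀ {m n} → m * m < n * n → m < n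
  m*m<n*n⇒m<n m²<n² = ≰⇒> λ n≤m → <⇒≱ m²<n² (*-mono-≤ n≤m n≤m)

  m*m≡n*n⇒m≡n : ∀ {m n} → m * m ≡ n * n → m ≡ n
  m*m≡n*n⇒m≡n m²≡n² =
    ≤-antisym (m*m≤n*n⇒m≤n (≤-reflexive m²≡n²)) (m*m≤n*n⇒m≤n (≤-reflexive (sym m²≡n²)))

  even⊎odd : ∀ n → (∃ λ k → n ≡ 2 * k) ⊎ (∃ λ k → n ≡ 1 + 2 * k)
  even⊎odd zero = inj₁ (0 , refl)
  even⊎odd (suc n) with even⊎odd n
  ... | inj₁ (k , refl) = inj₂ (k , refl)
  ... | inj₂ (k , refl) = inj₁ (suc k , sym (*-distribˡ-+ 2 1 k))

  coprime-*ʳ : ∀ {m n o} → Coprime m n → Coprime m o → Coprime m (n * o)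
  coprime-*ʳ m⊥n m⊥o (d∣m , d∣no) =
    m⊥o (d∣m , coprime-divisor (λ (e∣d , e∣n) → m⊥n (∣-trans e∣d d∣m , e∣n)) d∣no)

  coprime-square : ∀ {m n} → Coprime m n → Coprime (m * m) (n * n)
  coprime-square m⊥n = Coprime.sym (coprime-*ʳ n²⊥m n²⊥m)
    where n²⊥m = Coprime.sym (coprime-*ʳ m⊥n m⊥n)

  gcd[m*m,n*n]≡gcd[m,n]² : ∀ m n → gcd (m * m) (n * n) ≡ gcd m n * gcd m n
  gcd[m*m,n*n]≡gcd[m,n]² zero n =
    trans (gcd-identityˡ (n * n)) (sym (cong₂ _*_ (gcd-identityˡ n) (gcd-identityˡ n)))
  gcd[m*m,n*n]≡gcd[m,n]² m@(suc _) n = begin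
    gcd (m * m) (n * n)                             ≡⟨ cong₂ (λ i j → gcd (i * i) (j * j)) m≡m′g n≡n′g ⟩
    gcd ((m′ * g) * (m′ * g)) ((n′ * g) * (n′ * g)) ≡⟨ cong₂ gcd (regroup m′ g) (regroup n′ g) ⟩
    gcd (g * g * (m′ * m′)) (g * g * (n′ * n′))     ≡⟨ sym (c*gcd[m,n]≡gcd[cm,cn] (g * g) _ _) ⟩
    g * g * gcd (m′ * m′) (n′ * n′)                 ≡⟨ cong (g * g *_) gcd[m′²,n′²]≡1 ⟩
    g * g * 1                                       ≡⟨ *-identityʳ (g * g) ⟩
    g * g                                           ∎
    where
    open ≡-Reasoning
    g = gcd m n
    instance _ = ≢-nonZero (gcd[m,n]≢0 m n (inj₁ λ ()))
    m′ = m / g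
    n′ = n / g
    m≡m′g : m ≡ m′ * g
    m≡m′g = sym (m/n*n≡m (gcd[m,n]∣m m n))
    n≡n′g : n ≡ n′ * g
    n≡n′g = sym (m/n*n≡m (gcd[m,n]∣n m n))
    gcd[m′²,n′²]≡1 : gcd (m′ * m′) (n′ * n′) ≡ 1
    gcd[m′²,n′²]≡1 = coprime⇒gcd≡1 (coprime-square (coprime-/gcd m n))
    regroup : ∀ i j → (i * j) * (i * j) ≡ j * j * (i * i)
    regroup = solve-∀

  coprime∧m*n≡x²⇒m≡gcd[m,x]² : ∀ {m n x} → Coprime m n → m * n ≡ x * x → m ≡ gcd m x * gcd m x
  coprime∧m*n≡x²⇒m≡gcd[m,x]² {m} {n} {x} m⊥n mn≡x² = begin
    m                   ≡⟨ sym (*-identityʳ m) ⟩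
    m * 1               ≡⟨ cong (m *_) (sym (coprime⇒gcd≡1 m⊥n)) ⟩
    m * gcd m n         ≡⟨ c*gcd[m,n]≡gcd[cm,cn] m m n ⟩
    gcd (m * m) (m * n) ≡⟨ cong (gcd (m * m)) mn≡x² ⟩
    gcd (m * m) (x * x) ≡⟨ gcd[m*m,n*n]≡gcd[m,n]² m x ⟩
    gcd m x * gcd m x   ∎
    where open ≡-Reasoning

  coprime-square-factors : ∀ {m n x} → Coprime m n → m * n ≡ x * x →
    ∃₂ λ s t → m ≡ s * s × n ≡ t * t × x ≡ s * t
  coprime-square-factors {m} {n} {x} m⊥n mn≡x² = s , t , m≡s² , n≡t² , m*m≡n*n⇒m≡n (begin
    x * x             ≡⟨ sym mn≡x² ⟩
    m * n             ≡⟨ cong₂ _*_ m≡s² n≡t² ⟩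
    s * s * (t * t)   ≡⟨ [m*n]*[o*p]≡[m*o]*[n*p] s s t t ⟩
    (s * t) * (s * t) ∎)
    where
    open ≡-Reasoning
    s = gcd m x
    t = gcd n x
    m≡s² = coprime∧m*n≡x²⇒m≡gcd[m,x]² m⊥n mn≡x²
    n≡t² = coprime∧m*n≡x²⇒m≡gcd[m,x]² (Coprime.sym m⊥n) (trans (*-comm n m) mn≡x²)

  module _ {p} (p-prime : Prime p) where

    private instance _ = prime⇒nonZero p-prime

    prime-∣-square : ∀ {n k} → n * n ≡ p * k → p ∣ n
    prime-∣-square {n} {k} n²≡pk =
      [ id , id ]′ (euclidsLemma n n p-prime (divides k (trans n²≡pk (*-comm p k))))

    coprime-prime-square-factorsˡ : ∀ {m n x} → Coprime m n → m * n ≡ p * (x * x) → p ∣ m →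
      ∃₂ λ s t → m ≡ p * (s * s) × n ≡ t * t × x ≡ s * t
    coprime-prime-square-factorsˡ {n = n} {x} m⊥n mn≡px² (divides-refl α)
      with coprime-square-factors α⊥n αn≡x²
      where
      α⊥n : Coprime α n
      α⊥n (d∣α , d∣n) = m⊥n (∣-trans d∣α (m∣m*n p) , d∣n)
      αn≡x² : α * n ≡ x * x
      αn≡x² = *-cancelˡ-≡ _ _ p (trans (regroup α p n) mn≡px²)
        where
        regroup : ∀ α p n → p * (α * n) ≡ α * p * n
        regroup = solve-∀
    ... | s , t , α≡s² , n≡t² , x≡st = s , t , trans (*-comm α p) (cong (p *_) α≡s²) , n≡t² , x≡st

    coprime-prime-square-factors : ∀ {m n x} → Coprime m n → m * n ≡ p * (x * x) →
      (∃₂ λ s t → m ≡ p * (s * s) × n ≡ t * t × x ≡ s * t) ⊎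
      (∃₂ λ s t → m ≡ s * s × n ≡ p * (t * t) × x ≡ s * t)
    coprime-prime-square-factors {m} {n} {x} m⊥n mn≡px²
      with euclidsLemma m n p-prime (divides (x * x) (trans mn≡px² (*-comm p _)))
    ... | inj₁ p∣m = inj₁ (coprime-prime-square-factorsˡ m⊥n mn≡px² p∣m)
    ... | inj₂ p∣n with coprime-prime-square-factorsˡ (Coprime.sym m⊥n) (trans (*-comm n m) mn≡px²) p∣n
    ...   | t , s , n≡pt² , m≡s² , x≡ts = inj₂ (s , t , m≡s² , n≡pt² , trans x≡ts (*-comm t s))

    prime-nonsquare : ∀ q y → 0 < q → y * y ≢ p * (q * q)
    prime-nonsquare = <-rec (λ q → ∀ y → 0 < q → y * y ≢ p * (q * q)) descent
      where
      instance _ = prime⇒nonTrivial p-prime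
      cancel : ∀ y′ q → y′ * p * (y′ * p) ≡ p * (q * q) → p * (y′ * y′) ≡ q * q
      cancel y′ q eq = *-cancelˡ-≡ _ _ p (trans (regroup p y′) eq)
        where
        regroup : ∀ p y′ → p * (p * (y′ * y′)) ≡ y′ * p * (y′ * p)
        regroup = solve-∀
      descent : ∀ q → (∀ {q′} → q′ < q → ∀ y → 0 < q′ → y * y ≢ p * (q′ * q′)) →
        ∀ y → 0 < q → y * y ≢ p * (q * q)
      descent q smaller y 0<q y²≡pq² with prime-∣-square {y} y²≡pq²
      ... | divides-refl y′ with prime-∣-square {q} (sym (cancel y′ q y²≡pq²))
      ...   | divides-refl q′ =
        smaller q′<q′p y′ (>-nonZero⁻¹ q′) (sym (cancel q′ y′ (sym (cancel y′ (q′ * p) y²≡pq²))))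
        where
        instance _ = m*n≢0⇒m≢0 q′ {{>-nonZero 0<q}}
        q′<q′p : q′ < q′ * p
        q′<q′p = m<m*n q′ p (nonTrivial⇒n>1 p)

module SquaresMod8 where

  open import Data.Nat
  open import Data.Nat.Properties
  open import Data.Nat.DivMod
  open import Data.Fin using (Fin; toℕ; fromℕ<)
  open import Data.Fin.Properties using (all?; toℕ-fromℕ<)
  open import Relation.Nullary
  open import Relation.Binary.PropositionalEquality
  open import Data.Nat.Tactic.RingSolver

  [k*t²+c]%8 : ∀ k t c → (k * (t * t) + c) % 8 ≡ (k % 8 * (t % 8 * (t % 8)) + c) % 8
  [k*t²+c]%8 k t c = begin
    (k * (t * t) + c) % 8
      ≡⟨ cong₂ (λ k t → (k * (t * t) + c) % 8) (m≡m%n+[m/n]*n k 8) (m≡m%n+[m/n]*n t 8) ⟩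
    ((κ + K * 8) * ((r + q * 8) * (r + q * 8)) + c) % 8 ≡⟨ cong (_% 8) (expand κ K r q c) ⟩
    (κ * (r * r) + c + carry * 8) % 8               ≡⟨ [m+kn]%n≡m%n (κ * (r * r) + c) carry 8 ⟩
    (κ * (r * r) + c) % 8                           ∎
    where
    open ≡-Reasoning
    κ = k % 8
    K = k / 8
    r = t % 8
    q = t / 8
    carry = K * ((r + q * 8) * (r + q * 8)) + κ * (2 * r * q + q * q * 8)
    expand : ∀ κ K r q c → (κ + K * 8) * ((r + q * 8) * (r + q * 8)) + c ≡
      κ * (r * r) + c + (K * ((r + q * 8) * (r + q * 8)) + κ * (2 * r * q + q * q * 8)) * 8
    expand = solve-∀

  ≢-by-residues-mod-8 : ∀ {k c k′ c′} →
    (∀ (i j : Fin 8) → (k % 8 * (toℕ i * toℕ i) + c) % 8 ≢ (k′ % 8 * (toℕ j * toℕ j) + c′) % 8) →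
    ∀ t s → k * (t * t) + c ≢ k′ * (s * s) + c′
  ≢-by-residues-mod-8 {k} {c} {k′} {c′} residues≢ t s eq = residues≢ (residue t) (residue s) (begin
    (k % 8 * (toℕ (residue t) * toℕ (residue t)) + c) % 8   ≡⟨ cong (λ r → (k % 8 * (r * r) + c) % 8) (toℕ-residue t) ⟩
    (k % 8 * (t % 8 * (t % 8)) + c) % 8                     ≡⟨ sym ([k*t²+c]%8 k t c) ⟩
    (k * (t * t) + c) % 8                                   ≡⟨ cong (_% 8) eq ⟩
    (k′ * (s * s) + c′) % 8                                 ≡⟨ [k*t²+c]%8 k′ s c′ ⟩
    (k′ % 8 * (s % 8 * (s % 8)) + c′) % 8                   ≡⟨ cong (λ r → (k′ % 8 * (r * r) + c′) % 8) (sym (toℕ-residue s)) ⟩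
    (k′ % 8 * (toℕ (residue s) * toℕ (residue s)) + c′) % 8 ∎)
    where
    open ≡-Reasoning
    residue : ℕ → Fin 8
    residue n = fromℕ< (m%n<n n 8)
    toℕ-residue : ∀ n → toℕ (residue n) ≡ n % 8
    toℕ-residue n = toℕ-fromℕ< (m%n<n n 8)

  module _ {A} (A%8≡3 : A % 8 ≡ 3) where

    square+1≢A*square : ∀ t s → t * t + 1 ≢ A * (s * s)
    square+1≢A*square t s eq = ≢-by-residues-mod-8 {1} {1} {A} {0} residues≢ t s
      (trans (cong (_+ 1) (*-identityˡ (t * t))) (trans eq (sym (+-identityʳ (A * (s * s))))))
      where
      residues≢ : ∀ (i j : Fin 8) → (1 * (toℕ i * toℕ i) + 1) % 8 ≢ (A % 8 * (toℕ j * toℕ j) + 0) % 8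
      residues≢ rewrite A%8≡3 = toWitness {a? = all? λ i → all? λ j → ¬? (_ ≟ _)} _

    square≢A*square+2 : ∀ t s → t * t ≢ A * (s * s) + 2
    square≢A*square+2 t s eq = ≢-by-residues-mod-8 {1} {0} {A} {2} residues≢ t s
      (trans (+-identityʳ (1 * (t * t))) (trans (*-identityˡ (t * t)) eq))
      where
      residues≢ : ∀ (i j : Fin 8) → (1 * (toℕ i * toℕ i) + 0) % 8 ≢ (A % 8 * (toℕ j * toℕ j) + 2) % 8
      residues≢ rewrite A%8≡3 = toWitness {a? = all? λ i → all? λ j → ¬? (_ ≟ _)} _

module LeastSolution where

  open import Defs
  open import Data.Nat
  open import Data.Nat.Properties
  open import Data.Nat.Induction using (<-rec)
  open import Data.Product
  open import Relation.Nullary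
  open import Relation.Unary using (Pred; Decidable)
  open import Relation.Binary.PropositionalEquality

  Least : ∀ {ℓ} → Pred ℕ ℓ → ℕ → Set ℓ
  Least P m = P m × (∀ {k} → k < m → ¬ P k)

  least-witness : ∀ {ℓ} {P : Pred ℕ ℓ} → Decidable P → ∀ {n} → P n → ∃ (Least P)
  least-witness {P = P} P? {n} = <-rec (λ n → P n → ∃ (Least P)) search n
    where
    search : ∀ n → (∀ {k} → k < n → P k → ∃ (Least P)) → P n → ∃ (Least P)
    search n smaller Pn with anyUpTo? P? n
    ... | yes (k , k<n , Pk) = smaller k<n Pk
    ... | no none = n , Pn , λ k<n Pk → none (_ , k<n , Pk)

  pell-solution⇒y>0 : ∀ {A x y} → PellSolution A x y → 0 < y
  pell-solution⇒y>0 {y = zero} pell = contradiction (trans pell (+-comm _ 1)) λ ()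
  pell-solution⇒y>0 {y = suc _} _ = z<s

  PellSolvableAt : ℕ → ℕ → Set
  PellSolvableAt A x = 0 < x × ∃ λ y → PellSolution A x y

  pell-solvable-at? : ∀ A → Decidable (PellSolvableAt A)
  pell-solvable-at? A x = (0 <? x) ×-dec
    map′ (λ (y , _ , pell) → y , pell) (λ (y , pell) → y , y<bound pell , pell)
      (anyUpTo? (λ y → y * y ≟ A * (x * x) + 1) (suc (A * (x * x) + 1)))
    where
    y<bound : ∀ {y} → PellSolution A x y → y < suc (A * (x * x) + 1)
    y<bound {y} pell =
      s≤s (≤-trans (m≤m*n y y {{>-nonZero (pell-solution⇒y>0 {A} {x} pell)}}) (≤-reflexive pell))

  minimal-pell-solution : ∀ {A x} → PellSolvableAt A x → ∃ (IsMinimalPellSolution A)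
  minimal-pell-solution {A} solvable with least-witness (pell-solvable-at? A) solvable
  ... | x , (0<x , y , pell) , minimal = x , (0<x , y , pell-solution⇒y>0 {A} {x} pell , pell) ,
    λ x′ y′ 0<x′ _ pell′ → ≮⇒≥ λ x′<x → minimal x′<x (0<x′ , y′ , pell′)

module DirichletApproximation where

  open SquareFactors
  open import Data.Nat
  open import Data.Nat.Properties
  open import Data.Nat.DivMod
  open import Data.Fin using (Fin; toℕ; fromℕ<)
  open import Data.Fin.Properties using (pigeonhole; toℕ-fromℕ<; toℕ<n)
  open import Data.Product
  open import Data.List using (_∷_; [])
  open import Relation.Nullary
  open import Relation.Binary.PropositionalEquality
  open import Data.Nat.Tactic.RingSolver

  floor-sqrt : ∀ n → ∃ λ r → r * r ≤ n × n < suc r * suc r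
  floor-sqrt zero = 0 , z≤n , z<s
  floor-sqrt (suc n) with floor-sqrt n
  ... | r , r²≤n , n<[1+r]² with suc r * suc r ≤? suc n
  ...   | yes [1+r]²≤1+n = suc r , [1+r]²≤1+n , ≤-<-trans n<[1+r]² (*-mono-< (n<1+n (suc r)) (n<1+n (suc r)))
  ...   | no [1+r]²≰1+n = r , m≤n⇒m≤1+n r²≤n , ≰⇒> [1+r]²≰1+n

  -- Read G * G ≤ A * (c * c) as G ≤ c√A: these say that c ↦ c√A is additive.
  module _ {A c D G h : ℕ} where

    sqrt-+-mono-≤ : G * G ≤ A * (c * c) → h * h ≤ A * (D * D) → (G + h) * (G + h) ≤ A * ((c + D) * (c + D))
    sqrt-+-mono-≤ G²≤Ac² h²≤AD² = begin
      (G + h) * (G + h)                           ≡⟨ solve (G ∷ h ∷ []) ⟩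
      G * G + 2 * (G * h) + h * h                 ≤⟨ +-mono-≤ (+-mono-≤ G²≤Ac² (*-monoʳ-≤ 2 Gh≤AcD)) h²≤AD² ⟩
      A * (c * c) + 2 * (A * c * D) + A * (D * D) ≡⟨ solve (A ∷ c ∷ D ∷ []) ⟩
      A * ((c + D) * (c + D))                     ∎
      where
      open ≤-Reasoning
      Gh≤AcD : G * h ≤ A * c * D
      Gh≤AcD = m*m≤n*n⇒m≤n (begin
        (G * h) * (G * h)           ≡⟨ [m*n]*[o*p]≡[m*o]*[n*p] G h G h ⟩
        (G * G) * (h * h)           ≤⟨ *-mono-≤ G²≤Ac² h²≤AD² ⟩
        A * (c * c) * (A * (D * D)) ≡⟨ solve (A ∷ c ∷ D ∷ []) ⟩
        (A * c * D) * (A * c * D)   ∎)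

    sqrt-+-mono-< : A * (c * c) < G * G → A * (D * D) ≤ h * h → A * ((c + D) * (c + D)) < (G + h) * (G + h)
    sqrt-+-mono-< Ac²<G² AD²≤h² = begin-strict
      A * ((c + D) * (c + D))                     ≡⟨ solve (A ∷ c ∷ D ∷ []) ⟩
      A * (c * c) + 2 * (A * c * D) + A * (D * D) <⟨ +-mono-<-≤ (+-mono-<-≤ Ac²<G² (*-monoʳ-≤ 2 AcD≤Gh)) AD²≤h² ⟩
      G * G + 2 * (G * h) + h * h                 ≡⟨ solve (G ∷ h ∷ []) ⟩
      (G + h) * (G + h)                           ∎
      where
      open ≤-Reasoning
      AcD≤Gh : A * c * D ≤ G * h
      AcD≤Gh = m*m≤n*n⇒m≤n (begin
        (A * c * D) * (A * c * D)   ≡⟨ solve (A ∷ c ∷ D ∷ []) ⟩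
        A * (c * c) * (A * (D * D)) ≤⟨ *-mono-≤ (<⇒≤ Ac²<G²) AD²≤h² ⟩
        (G * G) * (h * h)           ≡⟨ [m*n]*[o*p]≡[m*o]*[n*p] G G h h ⟩
        (G * h) * (G * h)           ∎)

  %-≡⇒≡+* : ∀ {m n} N .{{_ : NonZero N}} → m ≤ n → m % N ≡ n % N → ∃ λ k → n ≡ m + k * N
  %-≡⇒≡+* {m} {n} N m≤n m%N≡n%N = n / N ∸ m / N , (begin
    n                                         ≡⟨ m≡m%n+[m/n]*n n N ⟩
    n % N + n / N * N
      ≡⟨ cong₂ (λ i j → i + j * N) (sym m%N≡n%N) (sym (m+[n∸m]≡n (/-monoˡ-≤ N m≤n))) ⟩
    m % N + (m / N + (n / N ∸ m / N)) * N     ≡⟨ regroup (m % N) (m / N) (n / N ∸ m / N) N ⟩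
    (m % N + m / N * N) + (n / N ∸ m / N) * N ≡⟨ cong (_+ (n / N ∸ m / N) * N) (sym (m≡m%n+[m/n]*n m N)) ⟩
    m + (n / N ∸ m / N) * N                   ∎)
    where
    open ≡-Reasoning
    regroup : ∀ r x y N → r + (x + y) * N ≡ (r + x * N) + y * N
    regroup = solve-∀

  -- (N y − 1)² < A (N q)² < (N y + 1)², that is |q√A − y| < 1/N.
  Approximation : ℕ → ℕ → ℕ → ℕ → Set
  Approximation A N y q = ∃ λ g → suc g ≡ N * y ×
    g * g < A * ((N * q) * (N * q)) × A * ((N * q) * (N * q)) < suc (N * y) * suc (N * y)

  module _ {A : ℕ} where

    ⌊_√A⌋ : ℕ → ℕ
    ⌊ c √A⌋ = proj₁ (floor-sqrt (A * (c * c)))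

    ⌊√A⌋-below : ∀ c → ⌊ c √A⌋ * ⌊ c √A⌋ ≤ A * (c * c)
    ⌊√A⌋-below c = proj₁ (proj₂ (floor-sqrt (A * (c * c))))

    ⌊√A⌋-above : ∀ c → A * (c * c) < suc ⌊ c √A⌋ * suc ⌊ c √A⌋
    ⌊√A⌋-above c = proj₂ (proj₂ (floor-sqrt (A * (c * c))))

    ⌊√A⌋-mono-≤ : ∀ {c d} → c ≤ d → ⌊ c √A⌋ ≤ ⌊ d √A⌋
    ⌊√A⌋-mono-≤ {c} {d} c≤d = s≤s⁻¹ (m*m<n*n⇒m<n (begin-strict
      ⌊ c √A⌋ * ⌊ c √A⌋         ≤⟨ ⌊√A⌋-below c ⟩
      A * (c * c)               ≤⟨ *-monoʳ-≤ A (*-mono-≤ c≤d c≤d) ⟩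
      A * (d * d)               <⟨ ⌊√A⌋-above d ⟩
      suc ⌊ d √A⌋ * suc ⌊ d √A⌋ ∎))
      where open ≤-Reasoning

    private
      module Collision (N′ q₁ q′ k : ℕ) where
        N = suc N′
        c = N * q₁
        D = N * suc q′
        G₁ = ⌊ c √A⌋
        G₂ = ⌊ N * (q₁ + suc q′) √A⌋

        N[q₁+q]≡c+D : N * (q₁ + suc q′) ≡ c + D
        N[q₁+q]≡c+D = *-distribˡ-+ N q₁ (suc q′)

        module _ (G₂≡G₁+kN : G₂ ≡ G₁ + k * N) where

          upper : A * (D * D) < suc (k * N) * suc (k * N)
          upper = ≰⇒> λ [1+kN]²≤AD² →
            <⇒≱ above (sqrt-+-mono-≤ {A} {c} {D} {G₁} {suc (k * N)} (⌊√A⌋-below c) [1+kN]²≤AD²)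
            where
            above : A * ((c + D) * (c + D)) < (G₁ + suc (k * N)) * (G₁ + suc (k * N))
            above = subst₂ (λ c+D G → A * (c+D * c+D) < G * G) N[q₁+q]≡c+D
              (trans (cong suc G₂≡G₁+kN) (sym (+-suc G₁ (k * N)))) (⌊√A⌋-above (N * (q₁ + suc q′)))

          lower : ∀ g → k * N ≡ suc g → g * g < A * (D * D)
          lower g kN≡1+g = ≰⇒> λ AD²≤g² →
            <⇒≱ (sqrt-+-mono-< {A} {c} {D} {suc G₁} {g} (⌊√A⌋-above c) AD²≤g²) below
            where
            below : (suc G₁ + g) * (suc G₁ + g) ≤ A * ((c + D) * (c + D))
            below = subst₂ (λ G c+D → G * G ≤ A * (c+D * c+D))
              (trans G₂≡G₁+kN (trans (cong (G₁ +_) kN≡1+g) (+-suc G₁ g))) N[q₁+q]≡c+D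
              (⌊√A⌋-below (N * (q₁ + suc q′)))

    module _ (0<A : 0 < A) where

      approximation-from-collision : ∀ N′ q₁ q′ → let N = suc N′ in
        ⌊ N * q₁ √A⌋ % N ≡ ⌊ N * (q₁ + suc q′) √A⌋ % N → ∃ λ y → Approximation A N y (suc q′)
      approximation-from-collision N′ q₁ q′ residues≡ with %-≡⇒≡+* (suc N′) G₁≤G₂ residues≡
        where
        G₁≤G₂ = ⌊√A⌋-mono-≤ (*-monoʳ-≤ (suc N′) (m≤m+n q₁ (suc q′)))
      ... | zero , G₂≡G₁ =
        contradiction (upper G₂≡G₁) (≤⇒≯ (*-mono-≤ {1} {A} {1} 0<A (*-mono-≤ {1} {D} {1} {D} z<s z<s)))
        where open Collision N′ q₁ q′ 0
      ... | suc k , G₂≡G₁+yN =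
        suc k , N′ + k * N , sym (*-comm N (suc k)) , lower G₂≡G₁+yN (N′ + k * N) refl ,
        subst (λ yN → A * (D * D) < suc yN * suc yN) (*-comm (suc k) N) (upper G₂≡G₁+yN)
        where open Collision N′ q₁ q′ (suc k)

      -- Abstract because only its statement is needed: unfolding the pigeonhole search makes
      -- checking its uses much slower.
      abstract
        dirichlet : ∀ N .{{_ : NonZero N}} → ∃₂ λ y q → 0 < q × q ≤ N × Approximation A N y q
        dirichlet N@(suc N′) with pigeonhole (n<1+n N) residue
          where
          residue : Fin (suc N) → Fin N
          residue i = fromℕ< (m%n<n ⌊ N * toℕ i √A⌋ N)
        ... | i , j , i<j , residue≡ with m≤n⇒∃[o]m+o≡n i<j
        ...   | q′ , 1+q₁+q′≡q₂ = y , suc q′ , z<s , q≤N , approximation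
          where
          q₁ : ℕ
          q₁ = toℕ i
          q₂≡ : toℕ j ≡ q₁ + suc q′
          q₂≡ = trans (sym 1+q₁+q′≡q₂) (sym (+-suc q₁ q′))
          residues≡ : ⌊ N * q₁ √A⌋ % N ≡ ⌊ N * (q₁ + suc q′) √A⌋ % N
          residues≡ = trans (sym (toℕ-fromℕ< _))
            (trans (cong toℕ residue≡) (trans (toℕ-fromℕ< _) (cong (λ q → ⌊ N * q √A⌋ % N) q₂≡)))
          q≤N : suc q′ ≤ N
          q≤N = ≤-trans (m≤n+m (suc q′) q₁) (≤-trans (≤-reflexive (sym q₂≡)) (s≤s⁻¹ (toℕ<n j)))
          y : ℕ
          y = proj₁ (approximation-from-collision N′ q₁ q′ residues≡)
          approximation : Approximation A N y (suc q′)
          approximation = proj₂ (approximation-from-collision N′ q₁ q′ residues≡)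

module Approximants where

  open SquareFactors
  open DirichletApproximation
  open import Data.Nat
  open import Data.Nat.Properties
  open import Data.Product
  open import Data.Sum
  open import Data.List using (_∷_; [])
  open import Function using (_∘_)
  open import Relation.Binary.PropositionalEquality
  open import Data.Nat.Tactic.RingSolver

  ∣-∣≤ : ∀ {a b c} → a ≤ b + c → b ≤ a + c → ∣ a - b ∣ ≤ c
  ∣-∣≤ {a} {b} {c} a≤b+c b≤a+c with ≤-total a b
  ... | inj₁ a≤b = begin
    ∣ a - b ∣ ≡⟨ m≤n⇒∣m-n∣≡n∸m a≤b ⟩
    b ∸ a     ≤⟨ ∸-monoˡ-≤ a b≤a+c ⟩
    a + c ∸ a ≡⟨ m+n∸m≡n a c ⟩
    c         ∎
    where open ≤-Reasoning
  ... | inj₂ b≤a = begin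
    ∣ a - b ∣ ≡⟨ m≤n⇒∣n-m∣≡n∸m b≤a ⟩
    a ∸ b     ≤⟨ ∸-monoˡ-≤ b a≤b+c ⟩
    b + c ∸ b ≡⟨ m+n∸m≡n b c ⟩
    c         ∎
    where open ≤-Reasoning

  ∣[1+g]²-X∣≤2[1+g] : ∀ {g X} → g * g < X → X < suc (suc g) * suc (suc g) →
    ∣ suc g * suc g - X ∣ ≤ 2 * suc g
  ∣[1+g]²-X∣≤2[1+g] {g} {X} g²<X X<[2+g]² = ∣-∣≤ (begin
    suc g * suc g       ≡⟨ expand g ⟩
    suc (g * g) + 2 * g ≤⟨ +-monoˡ-≤ (2 * g) g²<X ⟩
    X + 2 * g           ≤⟨ +-monoʳ-≤ X (*-monoʳ-≤ 2 (n≤1+n g)) ⟩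
    X + 2 * suc g       ∎) (s≤s⁻¹ (≤-trans X<[2+g]² (≤-reflexive (expand′ g))))
    where
    open ≤-Reasoning
    expand : ∀ g → suc g * suc g ≡ suc (g * g) + 2 * g
    expand = solve-∀
    expand′ : ∀ g → suc (suc g) * suc (suc g) ≡ suc (suc g * suc g + 2 * suc g)
    expand′ = solve-∀

  module _ {A} (0<A : 0 < A) where

    approximation-norm-bound : ∀ {N y q} .{{_ : NonZero N}} → Approximation A N y q →
      N * ∣ y * y - A * (q * q) ∣ ≤ 2 * y
    approximation-norm-bound {N} {y} {q} (g , 1+g≡Ny , below , above) = *-cancelˡ-≤ N (begin
      N * (N * ∣ y * y - A * (q * q) ∣)               ≡⟨ sym (*-assoc N N _) ⟩
      N * N * ∣ y * y - A * (q * q) ∣                 ≡⟨ *-distribˡ-∣-∣ (N * N) (y * y) (A * (q * q)) ⟩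
      ∣ N * N * (y * y) - N * N * (A * (q * q)) ∣     ≡⟨ cong₂ ∣_-_∣ (regroup N y) (regroup′ A N q) ⟩
      ∣ (N * y) * (N * y) - A * ((N * q) * (N * q)) ∣ ≡⟨ cong (λ P → ∣ P * P - A * ((N * q) * (N * q)) ∣) 1+g≡Ny ⟨
      ∣ suc g * suc g - A * ((N * q) * (N * q)) ∣     ≤⟨ ∣[1+g]²-X∣≤2[1+g] below above′ ⟩
      2 * suc g                                       ≡⟨ cong (2 *_) 1+g≡Ny ⟩
      2 * (N * y)                                     ≡⟨ regroup″ N y ⟩
      N * (2 * y)                                     ∎)
      where
      open ≤-Reasoning
      above′ : A * ((N * q) * (N * q)) < suc (suc g) * suc (suc g)
      above′ = subst (λ P → A * ((N * q) * (N * q)) < suc P * suc P) (sym 1+g≡Ny) above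
      regroup : ∀ N y → N * N * (y * y) ≡ (N * y) * (N * y)
      regroup = solve-∀
      regroup′ : ∀ A N q → N * N * (A * (q * q)) ≡ A * ((N * q) * (N * q))
      regroup′ = solve-∀
      regroup″ : ∀ N y → 2 * (N * y) ≡ N * (2 * y)
      regroup″ = solve-∀

    approximation-y≤AN : ∀ {N y q} .{{_ : NonZero N}} → q ≤ N → Approximation A N y q → y ≤ A * N
    approximation-y≤AN {N} {y} {q} q≤N (g , 1+g≡Ny , below , _) = *-cancelˡ-≤ N (begin
      N * y       ≡⟨ sym 1+g≡Ny ⟩
      suc g       ≤⟨ m*m<n*n⇒m<n g²<[ANN]² ⟩
      A * N * N   ≡⟨ regroup A N ⟩
      N * (A * N) ∎)
      where
      open ≤-Reasoning
      regroup : ∀ A N → A * N * N ≡ N * (A * N)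
      regroup = solve-∀
      g²<[ANN]² : g * g < (A * N * N) * (A * N * N)
      g²<[ANN]² = begin-strict
        g * g                       <⟨ below ⟩
        A * ((N * q) * (N * q))     ≤⟨ *-monoʳ-≤ A (*-mono-≤ (*-monoʳ-≤ N q≤N) (*-monoʳ-≤ N q≤N)) ⟩
        A * ((N * N) * (N * N))     ≤⟨ *-monoˡ-≤ ((N * N) * (N * N)) (m≤m*n A A {{>-nonZero 0<A}}) ⟩
        A * A * ((N * N) * (N * N)) ≡⟨ solve (A ∷ N ∷ []) ⟩
        (A * N * N) * (A * N * N)   ∎

  record Approximant (A : ℕ) : Set where
    field
      y q : ℕ
      0<q : 0 < q
      0<∣y²-Aq²∣ : 0 < ∣ y * y - A * (q * q) ∣
      ∣y²-Aq²∣≤2A : ∣ y * y - A * (q * q) ∣ ≤ 2 * A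

  module _ {A} (0<A : 0 < A) (nonsquare : ∀ y q → 0 < q → y * y ≢ A * (q * q)) where

    approximant-above : ∀ Y → ∃ λ (e : Approximant A) → Y < Approximant.y e
    approximant-above Y with dirichlet 0<A N
      where N = suc (2 * Y)
    ... | y , q , 0<q , q≤N , approximation = approximant , Y<y
      where
      N = suc (2 * Y)
      n = ∣ y * y - A * (q * q) ∣
      Nn≤2y : N * n ≤ 2 * y
      Nn≤2y = approximation-norm-bound 0<A {N} {y} {q} approximation
      0<n : 0 < n
      0<n = n≢0⇒n>0 (nonsquare y q 0<q ∘ ∣m-n∣≡0⇒m≡n)
      Y<y : Y < y
      Y<y = *-cancelˡ-< 2 Y y (≤-trans (m≤m*n N n {{>-nonZero 0<n}}) Nn≤2y)
      n≤2A : n ≤ 2 * A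
      n≤2A = *-cancelˡ-≤ N (begin
        N * n       ≤⟨ Nn≤2y ⟩
        2 * y       ≤⟨ *-monoʳ-≤ 2 (approximation-y≤AN 0<A {N} {y} {q} q≤N approximation) ⟩
        2 * (A * N) ≡⟨ regroup A N ⟩
        N * (2 * A) ∎)
        where
        open ≤-Reasoning
        regroup : ∀ A N → 2 * (A * N) ≡ N * (2 * A)
        regroup = solve-∀
      approximant : Approximant A
      approximant = record { y = y ; q = q ; 0<q = 0<q ; 0<∣y²-Aq²∣ = 0<n ; ∣y²-Aq²∣≤2A = n≤2A }

module Composition where

  open import Defs using (PellSolution)
  open SquareFactors using (m*m≡n*n⇒m≡n)
  open import Data.Nat as ℕ using (ℕ)
  import Data.Nat.Properties as ℕ
  open import Data.Nat.DivMod using (m≡m%n+[m/n]*n)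
  open import Data.Integer
  open import Data.Integer.Properties
  open import Data.Product
  open import Data.Sum using (inj₁; inj₂)
  open import Data.List using (_∷_; [])
  open import Relation.Binary.PropositionalEquality
  open import Data.Integer.Tactic.RingSolver

  sign◃1 : ℤ → ℤ
  sign◃1 i = sign i ◃ 1

  sign◃1*∣i∣≡i : ∀ i → sign◃1 i * + ∣ i ∣ ≡ i
  sign◃1*∣i∣≡i (+ n) = *-identityˡ (+ n)
  sign◃1*∣i∣≡i -[1+ n ] = -1*i≡-i +[1+ n ]

  sign◃1²≡1 : ∀ i → sign◃1 i * sign◃1 i ≡ 1ℤ
  sign◃1²≡1 (+ _) = refl
  sign◃1²≡1 -[1+ _ ] = refl

  i*i≡+∣i∣*∣i∣ : ∀ i → i * i ≡ + (∣ i ∣ ℕ.* ∣ i ∣)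
  i*i≡+∣i∣*∣i∣ (+ m) = sym (pos-* m m)
  i*i≡+∣i∣*∣i∣ -[1+ m ] = refl

  ∣+m-+n∣≡∣m-n∣ : ∀ m n → ∣ + m - + n ∣ ≡ ℕ.∣ m - n ∣
  ∣+m-+n∣≡∣m-n∣ m n with ℕ.≤-total m n
  ... | inj₁ m≤n = trans (cong ∣_∣ (m-n≡m⊖n m n))
    (trans (∣⊖∣-≤ m≤n) (sym (ℕ.m≤n⇒∣m-n∣≡n∸m m≤n)))
  ... | inj₂ n≤m = trans (cong ∣_∣ (m-n≡m⊖n m n))
    (trans (∣m⊖n∣≡∣n⊖m∣ m n) (trans (∣⊖∣-≤ n≤m) (sym (ℕ.m≤n⇒∣n-m∣≡n∸m n≤m))))

  ModEq : ℕ → ℕ → ℕ → Set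
  ModEq n a b = ∃ λ S → + b ≡ + a + + n * S

  %-≡⇒ModEq : ∀ {a b} n .{{_ : ℕ.NonZero n}} → a ℕ.% n ≡ b ℕ.% n → ModEq n a b
  %-≡⇒ModEq {a} {b} n a%n≡b%n = + (b ℕ./ n) - + (a ℕ./ n) , (begin
    + b                                              ≡⟨ decompose b ⟩
    + (b ℕ.% n) + + (b ℕ./ n) * + n                  ≡⟨ cong (λ r → + r + + (b ℕ./ n) * + n) (sym a%n≡b%n) ⟩
    + (a ℕ.% n) + + (b ℕ./ n) * + n                  ≡⟨ shift (+ (a ℕ.% n)) (+ (a ℕ./ n)) (+ (b ℕ./ n)) (+ n) ⟩
    + (a ℕ.% n) + + (a ℕ./ n) * + n + + n * (+ (b ℕ./ n) - + (a ℕ./ n))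
                                                     ≡⟨ cong (_+ + n * (+ (b ℕ./ n) - + (a ℕ./ n))) (sym (decompose a)) ⟩
    + a + + n * (+ (b ℕ./ n) - + (a ℕ./ n))          ∎)
    where
    open ≡-Reasoning
    decompose : ∀ m → + m ≡ + (m ℕ.% n) + + (m ℕ./ n) * + n
    decompose m = trans (cong +_ (m≡m%n+[m/n]*n m n))
      (trans (pos-+ (m ℕ.% n) _) (cong (_+_ (+ (m ℕ.% n))) (pos-* (m ℕ./ n) n)))
    shift : ∀ r a b n → r + b * n ≡ r + a * n + n * (b - a)
    shift = solve-∀

  brahmagupta : ∀ A y q y′ q′ →
    (y * y′ - A * (q * q′)) * (y * y′ - A * (q * q′)) - A * ((y * q′ - q * y′) * (y * q′ - q * y′)) ≡
    (y * y - A * (q * q)) * (y′ * y′ - A * (q′ * q′))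
  brahmagupta = solve-∀

  module Composite (A y q y′ q′ S T n σ : ℤ) (y′≡ : y′ ≡ y + n * S) (q′≡ : q′ ≡ q + n * T)
                   (norm : y * y - A * (q * q) ≡ σ * n) (norm′ : y′ * y′ - A * (q′ * q′) ≡ σ * n) where

    -- n (σ + y S − A q T) = y y′ − A q q′ and n (y T − q S) = y q′ − q y′, so Brahmagupta's
    -- identity divided by n² gives a solution of X² − A Y² = σ² = 1.
    pell-composition : .{{_ : NonZero (n * n)}} → σ * σ ≡ 1ℤ →
      (σ + y * S - A * q * T) * (σ + y * S - A * q * T) - A * ((y * T - q * S) * (y * T - q * S)) ≡ 1ℤ
    pell-composition σ²≡1 = *-cancelˡ-≡ (n * n) _ _ (begin
      n * n * (X * X - A * (Y * Y))                                   ≡⟨ scale A n X Y ⟩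
      (n * X) * (n * X) - A * ((n * Y) * (n * Y))                     ≡⟨ cong₂ (λ U V → U * U - A * (V * V)) nX≡ nY≡ ⟩
      (y * y′ - A * (q * q′)) * (y * y′ - A * (q * q′)) - A * ((y * q′ - q * y′) * (y * q′ - q * y′))
                                                                      ≡⟨ brahmagupta A y q y′ q′ ⟩
      (y * y - A * (q * q)) * (y′ * y′ - A * (q′ * q′))               ≡⟨ cong₂ _*_ norm norm′ ⟩
      (σ * n) * (σ * n)                                               ≡⟨ solve (n ∷ σ ∷ []) ⟩
      (σ * σ) * (n * n)                                               ≡⟨ cong (_* (n * n)) σ²≡1 ⟩
      1ℤ * (n * n)                                                    ≡⟨ solve (n ∷ []) ⟩
      n * n * 1ℤ                                                      ∎)
      where
      open ≡-Reasoning
      X = σ + y * S - A * q * T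
      Y = y * T - q * S
      scale : ∀ A n X Y → n * n * (X * X - A * (Y * Y)) ≡ (n * X) * (n * X) - A * ((n * Y) * (n * Y))
      scale = solve-∀
      nX≡ : n * (σ + y * S - A * q * T) ≡ y * y′ - A * (q * q′)
      nX≡ = begin
        n * (σ + y * S - A * q * T)                     ≡⟨ solve (A ∷ y ∷ q ∷ S ∷ T ∷ n ∷ σ ∷ []) ⟩
        σ * n + n * (y * S - A * q * T)                 ≡⟨ cong (_+ n * (y * S - A * q * T)) (sym norm) ⟩
        y * y - A * (q * q) + n * (y * S - A * q * T)   ≡⟨ solve (A ∷ y ∷ q ∷ S ∷ T ∷ n ∷ []) ⟩
        y * (y + n * S) - A * (q * (q + n * T))         ≡⟨ cong₂ (λ i j → y * i - A * (q * j)) (sym y′≡) (sym q′≡) ⟩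
        y * y′ - A * (q * q′)                           ∎
      nY≡ : n * (y * T - q * S) ≡ y * q′ - q * y′
      nY≡ = begin
        n * (y * T - q * S)             ≡⟨ solve (y ∷ q ∷ S ∷ T ∷ n ∷ []) ⟩
        y * (q + n * T) - q * (y + n * S) ≡⟨ cong₂ (λ i j → y * i - q * j) (sym q′≡) (sym y′≡) ⟩
        y * q′ - q * y′                 ∎

    composition-degenerate : .{{_ : NonZero (σ * n)}} → y * T ≡ q * S →
      q * q ≡ q′ * q′ × q * y′ ≡ y * q′
    composition-degenerate yT≡qS = q²≡q′² , qy′≡yq′
      where
      open ≡-Reasoning
      qy′≡yq′ : q * y′ ≡ y * q′
      qy′≡yq′ = begin
        q * y′              ≡⟨ cong (q *_) y′≡ ⟩
        q * (y + n * S)     ≡⟨ solve (y ∷ q ∷ S ∷ n ∷ []) ⟩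
        q * y + n * (q * S) ≡⟨ cong (λ qS → q * y + n * qS) (sym yT≡qS) ⟩
        q * y + n * (y * T) ≡⟨ solve (y ∷ q ∷ T ∷ n ∷ []) ⟩
        y * (q + n * T)     ≡⟨ cong (y *_) (sym q′≡) ⟩
        y * q′              ∎
      q²≡q′² : q * q ≡ q′ * q′
      q²≡q′² = *-cancelʳ-≡ _ _ (σ * n) (begin
        q * q * (σ * n)                               ≡⟨ cong (q * q *_) (sym norm′) ⟩
        q * q * (y′ * y′ - A * (q′ * q′))             ≡⟨ solve (A ∷ q ∷ y′ ∷ q′ ∷ []) ⟩
        (q * y′) * (q * y′) - A * (q * q) * (q′ * q′) ≡⟨ cong (λ z → z * z - A * (q * q) * (q′ * q′)) qy′≡yq′ ⟩
        (y * q′) * (y * q′) - A * (q * q) * (q′ * q′) ≡⟨ solve (A ∷ y ∷ q ∷ q′ ∷ []) ⟩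
        q′ * q′ * (y * y - A * (q * q))               ≡⟨ cong (q′ * q′ *_) norm ⟩
        q′ * q′ * (σ * n)                             ∎)

  proportional⇒equal : ∀ {y₁ q₁ y₂ q₂} → 0 ℕ.< q₁ →
    + q₁ * + q₁ ≡ + q₂ * + q₂ → + q₁ * + y₂ ≡ + y₁ * + q₂ → y₁ ≡ y₂
  proportional⇒equal {y₁} {q₁} {y₂} {q₂} 0<q₁ q₁²≡q₂² q₁y₂≡y₁q₂ =
    sym (ℕ.*-cancelˡ-≡ y₂ y₁ q₁ {{ℕ.>-nonZero 0<q₁}} (+-injective (begin
      + (q₁ ℕ.* y₂) ≡⟨ pos-* q₁ y₂ ⟩
      + q₁ * + y₂   ≡⟨ q₁y₂≡y₁q₂ ⟩
      + y₁ * + q₂   ≡⟨ cong (λ q → + y₁ * + q) (sym q₁≡q₂) ⟩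
      + y₁ * + q₁   ≡⟨ *-comm (+ y₁) (+ q₁) ⟩
      + q₁ * + y₁   ≡⟨ sym (pos-* q₁ y₁) ⟩
      + (q₁ ℕ.* y₁) ∎)))
    where
    open ≡-Reasoning
    q₁≡q₂ : q₁ ≡ q₂
    q₁≡q₂ = m*m≡n*n⇒m≡n (+-injective (trans (pos-* q₁ q₁) (trans q₁²≡q₂² (sym (pos-* q₂ q₂)))))

  module _ {A : ℕ} where

    norm : ℕ → ℕ → ℤ
    norm y q = + y * + y - + A * (+ q * + q)

    ∣norm∣≡∣y²-Aq²∣ : ∀ y q → ∣ norm y q ∣ ≡ ℕ.∣ y ℕ.* y - A ℕ.* (q ℕ.* q) ∣
    ∣norm∣≡∣y²-Aq²∣ y q = trans (cong ∣_∣ norm≡) (∣+m-+n∣≡∣m-n∣ (y ℕ.* y) (A ℕ.* (q ℕ.* q)))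
      where
      norm≡ : norm y q ≡ + (y ℕ.* y) - + (A ℕ.* (q ℕ.* q))
      norm≡ = cong₂ _-_ (sym (pos-* y y)) (trans (cong (+ A *_) (sym (pos-* q q))) (sym (pos-* A (q ℕ.* q))))

    integer-pell-solution : ∀ {X Y} → X * X - + A * (Y * Y) ≡ 1ℤ → PellSolution A ∣ Y ∣ ∣ X ∣
    integer-pell-solution {X} {Y} pell = +-injective (begin
      + (∣ X ∣ ℕ.* ∣ X ∣)                   ≡⟨ sym (i*i≡+∣i∣*∣i∣ X) ⟩
      X * X                                 ≡⟨ i≡i-j+j (X * X) (+ A * (Y * Y)) ⟩
      X * X - + A * (Y * Y) + + A * (Y * Y) ≡⟨ cong₂ (λ i j → i + + A * j) pell (i*i≡+∣i∣*∣i∣ Y) ⟩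
      1ℤ + + A * + (∣ Y ∣ ℕ.* ∣ Y ∣)        ≡⟨ cong (_+_ 1ℤ) (sym (pos-* A _)) ⟩
      + (1 ℕ.+ A ℕ.* (∣ Y ∣ ℕ.* ∣ Y ∣))     ≡⟨ cong +_ (ℕ.+-comm 1 _) ⟩
      + (A ℕ.* (∣ Y ∣ ℕ.* ∣ Y ∣) ℕ.+ 1)     ∎)
      where
      open ≡-Reasoning
      i≡i-j+j : ∀ i j → i ≡ i - j + j
      i≡i-j+j = solve-∀

    pell-from-congruent-pair : ∀ {y₁ q₁ y₂ q₂} → norm y₁ q₁ ≡ norm y₂ q₂ → let n = ∣ norm y₁ q₁ ∣ in
      0 ℕ.< n → ModEq n y₁ y₂ → ModEq n q₁ q₂ → 0 ℕ.< q₁ → y₁ ℕ.< y₂ → ∃₂ λ x y → 0 ℕ.< x × PellSolution A x y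
    pell-from-congruent-pair {y₁} {q₁} {y₂} {q₂} N₁≡N₂ 0<n (S , y₂≡) (T , q₂≡) 0<q₁ y₁<y₂ =
      ∣ Y ∣ , ∣ X ∣ , ℕ.n≢0⇒n>0 ∣Y∣≢0 , integer-pell-solution {X} {Y} (pell-composition (sign◃1²≡1 N))
      where
      N = norm y₁ q₁
      n = ∣ N ∣
      σ = sign◃1 N
      X = σ + + y₁ * S - + A * + q₁ * T
      Y = + y₁ * T - + q₁ * S
      N≡σn : N ≡ σ * + n
      N≡σn = sym (sign◃1*∣i∣≡i N)
      open Composite (+ A) (+ y₁) (+ q₁) (+ y₂) (+ q₂) S T (+ n) σ y₂≡ q₂≡ N≡σn (trans (sym N₁≡N₂) N≡σn)
      instance
        n≢0 : ℕ.NonZero n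
        n≢0 = ℕ.>-nonZero 0<n
        n²≢0 : NonZero (+ n * + n)
        n²≢0 = subst ℕ.NonZero (sym (abs-* (+ n) (+ n))) (ℕ.m*n≢0 n n)
        σn≢0 : NonZero (σ * + n)
        σn≢0 = subst NonZero N≡σn n≢0
      ∣Y∣≢0 : ∣ Y ∣ ≢ 0
      ∣Y∣≢0 ∣Y∣≡0 = ℕ.<-irrefl (proportional⇒equal 0<q₁ q₁²≡q₂² q₁y₂≡y₁q₂) y₁<y₂
        where
        degenerate = composition-degenerate (i-j≡0⇒i≡j _ _ (∣i∣≡0⇒i≡0 ∣Y∣≡0))
        q₁²≡q₂² = proj₁ degenerate
        q₁y₂≡y₁q₂ = proj₂ degenerate

module PellExistence where

  open import Defs using (PellSolution)
  open Approximants
  open Composition using (norm; ∣norm∣≡∣y²-Aq²∣; ModEq; %-≡⇒ModEq; pell-from-congruent-pair)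
  open import Data.Nat
  open import Data.Nat.Properties
  open import Data.Nat.DivMod using (m%n<n; %-congʳ)
  open import Data.Integer as ℤ using (ℤ; sign)
  open import Data.Integer.Properties using (◃-cong)
  open import Data.Sign as Sign using (Sign)
  open import Data.Fin using (Fin; toℕ; fromℕ<; combine) renaming (zero to 0F; suc to 1+F)
  open import Data.Fin.Properties using (pigeonhole; toℕ-fromℕ<; fromℕ<-injective; combine-injective)
  open import Data.Product
  open import Data.Sum
  open import Function using (_∘_)
  open import Relation.Binary.PropositionalEquality

  sign-index : Sign → Fin 2
  sign-index Sign.+ = 0F
  sign-index Sign.- = 1+F 0F

  sign-index-injective : ∀ {s t} → sign-index s ≡ sign-index t → s ≡ t
  sign-index-injective {Sign.+} {Sign.+} _ = refl
  sign-index-injective {Sign.-} {Sign.-} _ = refl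

  module _ {A} (0<A : 0 < A) (nonsquare : ∀ y q → 0 < q → y * y ≢ A * (q * q)) where

    open Approximant

    approximants : ℕ → Approximant A
    approximants zero = proj₁ (approximant-above 0<A nonsquare 0)
    approximants (suc k) = proj₁ (approximant-above 0<A nonsquare (y (approximants k)))

    approximants-increasing : ∀ {i j} → i < j → y (approximants i) < y (approximants j)
    approximants-increasing {i} {suc j} i<1+j with m<1+n⇒m<n∨m≡n i<1+j
    ... | inj₁ i<j = <-trans (approximants-increasing i<j) (proj₂ (approximant-above 0<A nonsquare _))
    ... | inj₂ refl = proj₂ (approximant-above 0<A nonsquare _)

    private
      K : ℕ
      K = 2 * A

      norm-of : Approximant A → ℤ
      norm-of e = norm {A} (y e) (q e)

      module _ (e : Approximant A) where

        ∣norm∣ : ℕ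
        ∣norm∣ = ℤ.∣ norm-of e ∣

        0<∣norm∣ : 0 < ∣norm∣
        0<∣norm∣ = subst (0 <_) (sym (∣norm∣≡∣y²-Aq²∣ {A} (y e) (q e))) (0<∣y²-Aq²∣ e)

        ∣norm∣≤K : ∣norm∣ ≤ K
        ∣norm∣≤K = subst (_≤ K) (sym (∣norm∣≡∣y²-Aq²∣ {A} (y e) (q e))) (∣y²-Aq²∣≤2A e)

        instance
          ∣norm∣≢0 : NonZero ∣norm∣
          ∣norm∣≢0 = >-nonZero 0<∣norm∣

        residue : ℕ → Fin K
        residue m = fromℕ< (<-≤-trans (m%n<n m ∣norm∣) ∣norm∣≤K)

        toℕ-residue : ∀ m → toℕ (residue m) ≡ m % ∣norm∣
        toℕ-residue m = toℕ-fromℕ< (<-≤-trans (m%n<n m ∣norm∣) ∣norm∣≤K)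

        signature : Fin 2 × Fin (suc K) × Fin K × Fin K
        signature = sign-index (sign (norm-of e)) , fromℕ< (s≤s ∣norm∣≤K) , residue (y e) , residue (q e)

      encode : Fin 2 × Fin (suc K) × Fin K × Fin K → Fin (2 * (suc K * (K * K)))
      encode (s , n , r , r′) = combine s (combine n (combine r r′))

      encode-injective : ∀ {a b} → encode a ≡ encode b → a ≡ b
      encode-injective {s , n , r , r′} {t , m , u , u′} eq
        with refl , eq′ ← combine-injective s _ t _ eq
        with refl , eq″ ← combine-injective n _ m _ eq′
        with refl , refl ← combine-injective r r′ u u′ eq″ = refl

      same-signature : ∀ {e₁ e₂} → signature e₁ ≡ signature e₂ →
        norm-of e₁ ≡ norm-of e₂ × ModEq (∣norm∣ e₁) (y e₁) (y e₂) × ModEq (∣norm∣ e₁) (q e₁) (q e₂)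
      same-signature {e₁} {e₂} signature≡ =
        ◃-cong (sign-index-injective (cong proj₁ signature≡)) n₁≡n₂ ,
        congruent (cong (proj₁ ∘ proj₂ ∘ proj₂) signature≡) ,
        congruent (cong (proj₂ ∘ proj₂ ∘ proj₂) signature≡)
        where
        instance
          _ = ∣norm∣≢0 e₁
          _ = ∣norm∣≢0 e₂
        n₁≡n₂ : ∣norm∣ e₁ ≡ ∣norm∣ e₂
        n₁≡n₂ = fromℕ<-injective _ _ (s≤s (∣norm∣≤K e₁)) (s≤s (∣norm∣≤K e₂))
          (cong (proj₁ ∘ proj₂) signature≡)
        congruent : ∀ {m₁ m₂} → residue e₁ m₁ ≡ residue e₂ m₂ → ModEq (∣norm∣ e₁) m₁ m₂
        congruent {m₁} {m₂} eq = %-≡⇒ModEq (∣norm∣ e₁) (begin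
          m₁ % ∣norm∣ e₁           ≡⟨ sym (toℕ-residue e₁ m₁) ⟩
          toℕ (residue e₁ m₁)      ≡⟨ cong toℕ eq ⟩
          toℕ (residue e₂ m₂)      ≡⟨ toℕ-residue e₂ m₂ ⟩
          m₂ % ∣norm∣ e₂           ≡⟨ %-congʳ (sym n₁≡n₂) ⟩
          m₂ % ∣norm∣ e₁           ∎)
          where open ≡-Reasoning

    -- Abstract so that `with` over a use of it does not try to evaluate the pigeonhole search.
    abstract
      pell-solvable : ∃₂ λ x y → 0 < x × PellSolution A x y
      pell-solvable with pigeonhole (n<1+n _) (λ i → encode (signature (approximants (toℕ i))))
      ... | i , j , i<j , signatures≡ =
        let N₁≡N₂ , y₁≡y₂ , q₁≡q₂ =
              same-signature {e₁} {e₂} (encode-injective {signature e₁} {signature e₂} signatures≡)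
        in pell-from-congruent-pair {A} N₁≡N₂ (0<∣norm∣ e₁) y₁≡y₂ q₁≡q₂ (0<q e₁) (approximants-increasing i<j)
        where
        e₁ e₂ : Approximant A
        e₁ = approximants (toℕ i)
        e₂ = approximants (toℕ j)

module MinimalSolution where

  open import Defs
  open SquareFactors
  open SquaresMod8
  open LeastSolution using (pell-solution⇒y>0)
  open import Data.Nat
  open import Data.Nat.Properties
  open import Data.Nat.Divisibility
  open import Data.Nat.DivMod using (m∣n⇒o%n%m≡o%m)
  open import Data.Nat.Coprimality using (Coprime)
  open import Data.Nat.Primality using (Prime; euclidsLemma; prime[2])
  open import Data.Product
  open import Data.Sum
  open import Function using (id)
  open import Relation.Nullary
  open import Relation.Binary.PropositionalEquality
  open import Data.Nat.Tactic.RingSolver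

  coprime-suc : ∀ n → Coprime n (suc n)
  coprime-suc n {d} (d∣n , d∣1+n) = ∣1⇒≡1 (∣m+n∣m⇒∣n (subst (d ∣_) (+-comm 1 n) d∣1+n) d∣n)

  coprime-odd-+2 : ∀ j → Coprime (1 + 2 * j) (1 + 2 * j + 2)
  coprime-odd-+2 j {d} (d∣z , d∣z+2) =
    ∣1⇒≡1 (∣m+n∣m⇒∣n (subst (d ∣_) (+-comm 1 (2 * j)) d∣z) (∣m⇒∣m*n j d∣2))
    where
    d∣2 = ∣m+n∣m⇒∣n d∣z+2 d∣z

  %8≡3⇒¬2∣ : ∀ {A} → A % 8 ≡ 3 → ¬ 2 ∣ A
  %8≡3⇒¬2∣ {A} A%8≡3 2∣A = 1≢0 (begin
    1         ≡⟨ cong (_% 2) (sym A%8≡3) ⟩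
    A % 8 % 2 ≡⟨ m∣n⇒o%n%m≡o%m 2 8 A (divides 4 refl) ⟩
    A % 2     ≡⟨ n∣m⇒m%n≡0 A 2 2∣A ⟩
    0         ∎)
    where
    open ≡-Reasoning
    1≢0 : 1 ≢ 0
    1≢0 ()

  pell-predecessor : ∀ {A x z} → PellSolution A x (suc z) → z * (z + 2) ≡ A * (x * x)
  pell-predecessor {A} {x} {z} pell = +-cancelʳ-≡ 1 _ _ (trans (square-suc z) pell)
    where
    square-suc : ∀ z → z * (z + 2) + 1 ≡ suc z * suc z
    square-suc = solve-∀

  module _ {A} (A-prime : Prime A) (A%8≡3 : A % 8 ≡ 3) where

    odd-pell-solution-descends : ∀ {x j} → 0 < x → PellSolution A x (suc (2 * j)) →
      ∃₂ λ s t → 0 < s × s < x × PellSolution A s t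
    odd-pell-solution-descends {x} {j} 0<x pell with 2∣x
      where
      2∣x : 2 ∣ x
      2∣x with euclidsLemma A (x * x) prime[2] (divides (j * suc j * 2) Ax²≡j[j+1]*2*2)
        where
        Ax²≡j[j+1]*2*2 : A * (x * x) ≡ j * suc j * 2 * 2
        Ax²≡j[j+1]*2*2 = trans (sym (pell-predecessor {A} {x} {2 * j} pell)) (regroup j)
          where
          regroup : ∀ j → 2 * j * (2 * j + 2) ≡ j * suc j * 2 * 2
          regroup = solve-∀
      ... | inj₁ 2∣A = contradiction 2∣A (%8≡3⇒¬2∣ A%8≡3)
      ... | inj₂ 2∣x² = [ id , id ]′ (euclidsLemma x x prime[2] 2∣x²)
    ... | divides-refl x′ with coprime-prime-square-factors A-prime (coprime-suc j) j[j+1]≡Ax′²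
      where
      j[j+1]≡Ax′² : j * suc j ≡ A * (x′ * x′)
      j[j+1]≡Ax′² = *-cancelˡ-≡ _ _ 4
        (trans (quadruple j) (trans (pell-predecessor {A} {x′ * 2} {2 * j} pell) (halve A x′)))
        where
        quadruple : ∀ j → 4 * (j * suc j) ≡ 2 * j * (2 * j + 2)
        quadruple = solve-∀
        halve : ∀ A x′ → A * (x′ * 2 * (x′ * 2)) ≡ 4 * (A * (x′ * x′))
        halve = solve-∀
    ... | inj₂ (s , t , j≡s² , 1+j≡At² , _) =
      contradiction (trans (+-comm (s * s) 1) (trans (cong suc (sym j≡s²)) 1+j≡At²))
        (square+1≢A*square {A} A%8≡3 s t)
    ... | inj₁ (s , t , j≡As² , 1+j≡t² , x′≡st) = s , t , >-nonZero⁻¹ s , s<x , pell′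
      where
      pell′ : PellSolution A s t
      pell′ = trans (sym 1+j≡t²) (trans (+-comm 1 j) (cong (_+ 1) j≡As²))
      instance
        x′≢0 : NonZero x′
        x′≢0 = m*n≢0⇒m≢0 x′ {{>-nonZero 0<x}}
        st≢0 : NonZero (s * t)
        st≢0 = subst NonZero x′≡st x′≢0
        s≢0 : NonZero s
        s≢0 = m*n≢0⇒m≢0 s
        t≢0 : NonZero t
        t≢0 = m*n≢0⇒n≢0 s
      s<x : s < x′ * 2
      s<x = ≤-<-trans (≤-trans (m≤m*n s t) (≤-reflexive (sym x′≡st))) (m<m*n x′ 2 (s≤s (s≤s z≤n)))

    even-pell-solution-factors : ∀ {x j} → PellSolution A x (2 + 2 * j) →
      ∃₂ λ u v → u * u + 2 ≡ A * (v * v) × x ≡ u * v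
    even-pell-solution-factors {x} {j} pell
      with coprime-prime-square-factors A-prime (coprime-odd-+2 j) (pell-predecessor {A} {x} {1 + 2 * j} pell)
    ... | inj₁ (s , t , z≡As² , z+2≡t² , _) =
      contradiction (trans (sym z+2≡t²) (cong (_+ 2) z≡As²)) (square≢A*square+2 {A} A%8≡3 t s)
    ... | inj₂ (u , v , z≡u² , z+2≡Av² , x≡uv) = u , v , trans (cong (_+ 2) (sym z≡u²)) z+2≡Av² , x≡uv

    minimal-pell-solution-factors : ∀ {x} → IsMinimalPellSolution A x →
      ∃₂ λ u v → u * u + 2 ≡ A * (v * v) × x ≡ u * v
    minimal-pell-solution-factors ((0<x , suc z , _ , pell) , minimal) with even⊎odd z
    ... | inj₂ (j , refl) = even-pell-solution-factors {j = j} pell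
    ... | inj₁ (j , refl) with odd-pell-solution-descends {j = j} 0<x pell
    ...   | s , t , 0<s , s<x , pell′ =
      contradiction (minimal s t 0<s (pell-solution⇒y>0 {A} {s} pell′) pell′) (<⇒≱ s<x)

module ConjugateFactor where

  open import Data.Nat
  open import Data.Nat.Properties
  open import Data.Nat.Divisibility
  open import Data.Nat.Primality using (Prime; euclidsLemma; prime⇒nonZero)
  open import Data.Product
  open import Data.Sum
  open import Data.List using (_∷_; [])
  open import Relation.Nullary
  open import Relation.Binary.PropositionalEquality
  open import Data.Nat.Tactic.RingSolver

  module _ {p} (p-prime : Prime p) where

    private instance _ = prime⇒nonZero p-prime

    ¬∣-positive-below : ∀ {s} → 0 < s → s < p → ¬ p ∣ s
    ¬∣-positive-below 0<s s<p p∣s = <⇒≱ s<p (∣⇒≤ {{>-nonZero 0<s}} p∣s)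

    ∣-quotient : ∀ {s} → p ∣ s → ∃ λ q → s ≡ p * q
    ∣-quotient (divides q s≡qp) = q , trans s≡qp (*-comm q p)

    square-roots-mod-prime : ∀ {X a k l} → a < p → X * X + p * k ≡ a * a + p * l →
      ∃ λ E → X ≡ a + p * E ⊎ X + a ≡ p * E
    square-roots-mod-prime {X} {a} {k} {l} a<p eq with ≤-<-connex a X
    ... | inj₁ a≤X with m≤n⇒∃[o]m+o≡n a≤X
    ...   | t , refl with euclidsLemma t (2 * a + t) p-prime (∣m+n∣m⇒∣n (subst (p ∣_) difference (m∣m*n l)) (m∣m*n k))
      where
      difference : p * l ≡ p * k + t * (2 * a + t)
      difference = +-cancelˡ-≡ (a * a) _ _ (trans (sym eq) (expand a t (p * k)))
        where
        expand : ∀ a t pk → (a + t) * (a + t) + pk ≡ a * a + (pk + t * (2 * a + t))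
        expand = solve-∀
    ...     | inj₁ p∣t = let E , t≡pE = ∣-quotient p∣t in E , inj₁ (cong (a +_) t≡pE)
    ...     | inj₂ p∣2a+t = let E , 2a+t≡pE = ∣-quotient p∣2a+t in E , inj₂ (trans (regroup a t) 2a+t≡pE)
      where
      regroup : ∀ a t → a + t + a ≡ 2 * a + t
      regroup = solve-∀
    square-roots-mod-prime {X} {a} {k} {l} a<p eq | inj₂ X<a with m≤n⇒∃[o]m+o≡n X<a
    ... | o , refl with euclidsLemma (suc o) (2 * X + suc o) p-prime
                          (∣m+n∣m⇒∣n (subst (p ∣_) difference (m∣m*n k)) (m∣m*n l))
      where
      difference : p * k ≡ p * l + suc o * (2 * X + suc o)
      difference = +-cancelˡ-≡ (X * X) _ _ (trans eq (expand X o (p * l)))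
        where
        expand : ∀ X o pl → (suc X + o) * (suc X + o) + pl ≡ X * X + (pl + suc o * (2 * X + suc o))
        expand = solve-∀
    ...   | inj₁ p∣t =
      contradiction p∣t (¬∣-positive-below z<s (≤-<-trans (m≤n+m (suc o) X) (subst (_< p) (sym (+-suc X o)) a<p)))
    ...   | inj₂ p∣2X+t = let E , 2X+t≡pE = ∣-quotient p∣2X+t in E , inj₂ (trans (regroup X o) 2X+t≡pE)
      where
      regroup : ∀ X o → X + (suc X + o) ≡ 2 * X + suc o
      regroup = solve-∀

    cancel-mod-prime : ∀ {b X c k l} → ¬ p ∣ b → c < p → b * X + p * k ≡ b * c + p * l →
      ∃ λ C → X ≡ c + p * C
    cancel-mod-prime {b} {X} {c} {k} {l} p∤b c<p eq with ≤-<-connex c X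
    ... | inj₁ c≤X with m≤n⇒∃[o]m+o≡n c≤X
    ...   | s , refl with euclidsLemma b s p-prime (∣m+n∣m⇒∣n (subst (p ∣_) difference (m∣m*n l)) (m∣m*n k))
      where
      difference : p * l ≡ p * k + b * s
      difference = +-cancelˡ-≡ (b * c) _ _ (trans (sym eq) (expand b c s (p * k)))
        where
        expand : ∀ b c s pk → b * (c + s) + pk ≡ b * c + (pk + b * s)
        expand = solve-∀
    ...     | inj₁ p∣b = contradiction p∣b p∤b
    ...     | inj₂ p∣s = let C , s≡pC = ∣-quotient p∣s in C , cong (c +_) s≡pC
    cancel-mod-prime {b} {X} {c} {k} {l} p∤b c<p eq | inj₂ X<c with m≤n⇒∃[o]m+o≡n X<c
    ... | o , refl with euclidsLemma b (suc o) p-prime (∣m+n∣m⇒∣n (subst (p ∣_) difference (m∣m*n k)) (m∣m*n l))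
      where
      difference : p * k ≡ p * l + b * suc o
      difference = +-cancelˡ-≡ (b * X) _ _ (trans eq (expand b X o (p * l)))
        where
        expand : ∀ b X o pl → b * (suc X + o) + pl ≡ b * X + (pl + b * suc o)
        expand = solve-∀
    ...   | inj₁ p∣b = contradiction p∣b p∤b
    ...   | inj₂ p∣s =
      contradiction p∣s (¬∣-positive-below z<s (≤-<-trans (m≤n+m (suc o) X) (subst (_< p) (sym (+-suc X o)) c<p)))

  Adjacent : ℕ → ℕ → Set
  Adjacent m n = m ≡ n + 1 ⊎ n ≡ m + 1

  adjacent-squares : ∀ {X N m n} → X + 2 * (m * m) + 2 * (n * n) ≡ N + 4 * (n * m) → Adjacent m n → X + 2 ≡ N
  adjacent-squares {X} {N} {m} {n} eq (inj₁ refl) =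
    +-cancelʳ-≡ (4 * (n * (n + 1))) _ _ (trans (regroup X n) eq)
    where
    regroup : ∀ X n → X + 2 + 4 * (n * (n + 1)) ≡ X + 2 * ((n + 1) * (n + 1)) + 2 * (n * n)
    regroup = solve-∀
  adjacent-squares {X} {N} {m} {n} eq (inj₂ refl) =
    +-cancelʳ-≡ (4 * ((m + 1) * m)) _ _ (trans (regroup X m) eq)
    where
    regroup : ∀ X m → X + 2 + 4 * ((m + 1) * m) ≡ X + 2 * (m * m) + 2 * ((m + 1) * (m + 1))
    regroup = solve-∀

  -- Brahmagupta's identity (aC + 2bE)² + 2(bC − aE)² = (a² + 2b²)(C² + 2E²) with |bC − aE| = 1.
  norm-* : ∀ {a b C E} → Adjacent (b * C) (a * E) →
    (a * C + 2 * (b * E)) * (a * C + 2 * (b * E)) + 2 ≡ (a * a + 2 * (b * b)) * (C * C + 2 * (E * E))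
  norm-* {a} {b} {C} {E} adjacent = adjacent-squares (brahmagupta a b C E) adjacent
    where
    brahmagupta : ∀ a b C E →
      (a * C + 2 * (b * E)) * (a * C + 2 * (b * E)) + 2 * ((b * C) * (b * C)) + 2 * ((a * E) * (a * E)) ≡
      (a * a + 2 * (b * b)) * (C * C + 2 * (E * E)) + 4 * ((a * E) * (b * C))
    brahmagupta = solve-∀

  ConjugateFactor : ℕ → ℕ → ℕ → ℕ → Set
  ConjugateFactor a b u v =
    ∃₂ λ C E → u ≡ a * C + 2 * (b * E) × C * C + 2 * (E * E) ≡ v * v × Adjacent (b * C) (a * E)

  -- The prime A = (a + b√−2)(a − b√−2) divides u² + 2 = (u + √−2)(u − √−2) in ℤ[√−2], so
  -- u ± √−2 = (a − b√−2)(C ± E√−2) for a choice of sign; over ℕ this says b u ≡ ±a and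
  -- u a ≡ ∓2b (mod A), with E and C the quotients.
  module _ {A a b u v} (A-prime : Prime A) (A≡ : A ≡ a * a + 2 * (b * b)) (0<a : 0 < a) (0<b : 0 < b)
           (norm-u : u * u + 2 ≡ A * (v * v)) where

    private instance _ = prime⇒nonZero A-prime

    private
      a<A : a < A
      a<A = begin-strict
        a                   ≤⟨ m≤m*n a a {{>-nonZero 0<a}} ⟩
        a * a               <⟨ m<m+n (a * a) (*-monoʳ-< 2 (*-mono-< 0<b 0<b)) ⟩
        a * a + 2 * (b * b) ≡⟨ sym A≡ ⟩
        A                   ∎
        where open ≤-Reasoning

      2b<A : 2 * b < A
      2b<A = begin-strict
        2 * b               ≤⟨ *-monoʳ-≤ 2 (m≤m*n b b {{>-nonZero 0<b}}) ⟩
        2 * (b * b)         <⟨ m<n+m (2 * (b * b)) (*-mono-< 0<a 0<a) ⟩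
        a * a + 2 * (b * b) ≡⟨ sym A≡ ⟩
        A                   ∎
        where open ≤-Reasoning

      A∤b : ¬ A ∣ b
      A∤b = ¬∣-positive-below A-prime 0<b (≤-<-trans (m≤m+n b (b + 0)) 2b<A)

      bu²≡a²-mod-A : (b * u) * (b * u) + A * 1 ≡ a * a + A * ((b * v) * (b * v))
      bu²≡a²-mod-A = begin
        (b * u) * (b * u) + A * 1                 ≡⟨ cong (λ k → (b * u) * (b * u) + k * 1) A≡ ⟩
        (b * u) * (b * u) + (a * a + 2 * (b * b)) * 1 ≡⟨ solve (a ∷ b ∷ u ∷ []) ⟩
        a * a + (b * b) * (u * u + 2)             ≡⟨ cong (λ k → a * a + (b * b) * k) norm-u ⟩
        a * a + (b * b) * (A * (v * v))           ≡⟨ solve (a ∷ b ∷ A ∷ v ∷ []) ⟩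
        a * a + A * ((b * v) * (b * v))           ∎
        where open ≡-Reasoning

      conjugate-factor-from : ∀ {C E} → u ≡ a * C + 2 * (b * E) → Adjacent (b * C) (a * E) → ConjugateFactor a b u v
      conjugate-factor-from {C} {E} u≡ adjacent = C , E , u≡ , *-cancelˡ-≡ _ _ A (begin
        A * (C * C + 2 * (E * E))                 ≡⟨ cong (_* (C * C + 2 * (E * E))) A≡ ⟩
        (a * a + 2 * (b * b)) * (C * C + 2 * (E * E)) ≡⟨ sym (norm-* {a} {b} {C} {E} adjacent) ⟩
        (a * C + 2 * (b * E)) * (a * C + 2 * (b * E)) + 2 ≡⟨ cong (λ k → k * k + 2) (sym u≡) ⟩
        u * u + 2                                 ≡⟨ norm-u ⟩
        A * (v * v)                               ∎) , adjacent
        where open ≡-Reasoning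

      module _ {E} (bu≡a+AE : b * u ≡ a + A * E) where

        b[ua+2b]≡A[aE+1] : b * (u * a + 2 * b) + A * 0 ≡ b * 0 + A * (a * E + 1)
        b[ua+2b]≡A[aE+1] = begin
          b * (u * a + 2 * b) + A * 0       ≡⟨ solve (A ∷ a ∷ b ∷ u ∷ []) ⟩
          a * (b * u) + 2 * (b * b)         ≡⟨ cong (λ k → a * k + 2 * (b * b)) bu≡a+AE ⟩
          a * (a + A * E) + 2 * (b * b)     ≡⟨ solve (a ∷ b ∷ A ∷ E ∷ []) ⟩
          a * a + 2 * (b * b) + A * (a * E) ≡⟨ cong (_+ A * (a * E)) (sym A≡) ⟩
          A + A * (a * E)                   ≡⟨ solve (A ∷ a ∷ b ∷ E ∷ []) ⟩
          b * 0 + A * (a * E + 1)           ∎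
          where open ≡-Reasoning

        module _ {C} (ua+2b≡AC : u * a + 2 * b ≡ A * C) where

          bC≡aE+1 : b * C ≡ a * E + 1
          bC≡aE+1 = *-cancelˡ-≡ _ _ A (+-cancelʳ-≡ (A * 0) _ _ (begin
            A * (b * C) + A * 0         ≡⟨ solve (A ∷ b ∷ C ∷ []) ⟩
            b * (A * C) + A * 0         ≡⟨ cong (λ k → b * k + A * 0) (sym ua+2b≡AC) ⟩
            b * (u * a + 2 * b) + A * 0 ≡⟨ b[ua+2b]≡A[aE+1] ⟩
            b * 0 + A * (a * E + 1)     ≡⟨ solve (A ∷ a ∷ b ∷ E ∷ []) ⟩
            A * (a * E + 1) + A * 0     ∎))
            where open ≡-Reasoning

          u≡aC+2bE : u ≡ a * C + 2 * (b * E)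
          u≡aC+2bE = *-cancelˡ-≡ _ _ A (+-cancelʳ-≡ (2 * (a * b)) _ _ (begin
            A * u + 2 * (a * b)                     ≡⟨ cong (λ k → k * u + 2 * (a * b)) A≡ ⟩
            (a * a + 2 * (b * b)) * u + 2 * (a * b) ≡⟨ solve (a ∷ b ∷ u ∷ []) ⟩
            a * (u * a + 2 * b) + 2 * (b * (b * u)) ≡⟨ cong₂ (λ i j → a * i + 2 * (b * j)) ua+2b≡AC bu≡a+AE ⟩
            a * (A * C) + 2 * (b * (a + A * E))     ≡⟨ solve (A ∷ a ∷ b ∷ C ∷ E ∷ []) ⟩
            A * (a * C + 2 * (b * E)) + 2 * (a * b) ∎))
            where open ≡-Reasoning

      module _ {E} (bu+a≡AE : b * u + a ≡ A * E) where

        bua+A≡b2b+AaE : b * (u * a) + A * 1 ≡ b * (2 * b) + A * (a * E)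
        bua+A≡b2b+AaE = begin
          b * (u * a) + A * 1                     ≡⟨ cong (λ k → b * (u * a) + k * 1) A≡ ⟩
          b * (u * a) + (a * a + 2 * (b * b)) * 1 ≡⟨ solve (a ∷ b ∷ u ∷ []) ⟩
          a * (b * u + a) + b * (2 * b)           ≡⟨ cong (λ k → a * k + b * (2 * b)) bu+a≡AE ⟩
          a * (A * E) + b * (2 * b)               ≡⟨ solve (a ∷ b ∷ A ∷ E ∷ []) ⟩
          b * (2 * b) + A * (a * E)               ∎
          where open ≡-Reasoning

        module _ {C} (ua≡2b+AC : u * a ≡ 2 * b + A * C) where

          aE≡bC+1 : a * E ≡ b * C + 1
          aE≡bC+1 = *-cancelˡ-≡ _ _ A (+-cancelʳ-≡ (b * (2 * b)) _ _ (begin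
            A * (a * E) + b * (2 * b)           ≡⟨ solve (A ∷ a ∷ b ∷ E ∷ []) ⟩
            a * (A * E) + b * (2 * b)           ≡⟨ cong (λ k → a * k + b * (2 * b)) (sym bu+a≡AE) ⟩
            a * (b * u + a) + b * (2 * b)       ≡⟨ solve (a ∷ b ∷ u ∷ []) ⟩
            b * (u * a) + (a * a + 2 * (b * b)) ≡⟨ cong₂ (λ i j → b * i + j) ua≡2b+AC (sym A≡) ⟩
            b * (2 * b + A * C) + A             ≡⟨ solve (A ∷ b ∷ C ∷ []) ⟩
            A * (b * C + 1) + b * (2 * b)       ∎))
            where open ≡-Reasoning

          u≡aC+2bE′ : u ≡ a * C + 2 * (b * E)
          u≡aC+2bE′ = *-cancelˡ-≡ _ _ A (+-cancelʳ-≡ (2 * (a * b)) _ _ (begin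
            A * u + 2 * (a * b)                     ≡⟨ cong (λ k → k * u + 2 * (a * b)) A≡ ⟩
            (a * a + 2 * (b * b)) * u + 2 * (a * b) ≡⟨ solve (a ∷ b ∷ u ∷ []) ⟩
            a * (u * a) + 2 * (b * (b * u + a))     ≡⟨ cong₂ (λ i j → a * i + 2 * (b * j)) ua≡2b+AC bu+a≡AE ⟩
            a * (2 * b + A * C) + 2 * (b * (A * E)) ≡⟨ solve (A ∷ a ∷ b ∷ C ∷ E ∷ []) ⟩
            A * (a * C + 2 * (b * E)) + 2 * (a * b) ∎))
            where open ≡-Reasoning

    conjugate-factor : ConjugateFactor a b u v
    conjugate-factor with square-roots-mod-prime A-prime a<A bu²≡a²-mod-A
    ... | E , inj₁ bu≡a+AE with cancel-mod-prime A-prime A∤b (>-nonZero⁻¹ A) (b[ua+2b]≡A[aE+1] bu≡a+AE)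
    ...   | C , ua+2b≡AC = conjugate-factor-from (u≡aC+2bE bu≡a+AE ua+2b≡AC) (inj₁ (bC≡aE+1 bu≡a+AE ua+2b≡AC))
    conjugate-factor | E , inj₂ bu+a≡AE with cancel-mod-prime A-prime A∤b 2b<A (bua+A≡b2b+AaE bu+a≡AE)
    ...   | C , ua≡2b+AC = conjugate-factor-from (u≡aC+2bE′ bu+a≡AE ua≡2b+AC) (inj₂ (aE≡bC+1 bu+a≡AE ua≡2b+AC))

module Parametrisation where

  open SquareFactors
  open import Data.Nat
  open import Data.Nat.Properties
  open import Data.Nat.Divisibility
  open import Data.Nat.Coprimality using (Coprime)
  open import Data.Nat.Primality using (euclidsLemma; prime[2])
  open import Data.Product
  open import Data.Sum
  open import Relation.Binary.PropositionalEquality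
  open import Data.Nat.Tactic.RingSolver

  square≡double : ∀ {n k} → n * n ≡ 2 * k → ∃ λ h → n ≡ 2 * h × k ≡ 2 * (h * h)
  square≡double {n} {k} n²≡2k with prime-∣-square prime[2] {n} {k} n²≡2k
  ... | divides-refl h = h , *-comm h 2 , *-cancelˡ-≡ _ _ 2 (trans (sym n²≡2k) (regroup h))
    where
    regroup : ∀ h → h * 2 * (h * 2) ≡ 2 * (2 * (h * h))
    regroup = solve-∀

  square-gap : ∀ {C E v} → C * C + 2 * (E * E) ≡ v * v → ∃ λ d → v ≡ C + d × d * (2 * C + d) ≡ 2 * (E * E)
  square-gap {C} {E} {v} C²+2E²≡v² with m≤n⇒∃[o]m+o≡n C≤v
    where
    C≤v : C ≤ v
    C≤v = m*m≤n*n⇒m≤n (≤-trans (m≤m+n (C * C) _) (≤-reflexive C²+2E²≡v²))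
  ... | d , refl = d , refl , +-cancelˡ-≡ (C * C) _ _ (trans (expand C d) (sym C²+2E²≡v²))
    where
    expand : ∀ C d → C * C + d * (2 * C + d) ≡ (C + d) * (C + d)
    expand = solve-∀

  halve-square-gap : ∀ {C E d} → d * (2 * C + d) ≡ 2 * (E * E) →
    ∃₂ λ α K → d ≡ 2 * α × E ≡ 2 * K × α * (C + α) ≡ 2 * (K * K)
  halve-square-gap {C} {E} {d} gap with 2∣d
    where
    2∣d : 2 ∣ d
    2∣d with euclidsLemma d (2 * C + d) prime[2] (divides (E * E) (trans gap (*-comm 2 (E * E))))
    ... | inj₁ 2∣d = 2∣d
    ... | inj₂ 2∣2C+d = ∣m+n∣m⇒∣n 2∣2C+d (m∣m*n C)
  ... | divides-refl α =
    let K , E≡2K , α[C+α]≡2K² = square≡double E²≡2α[C+α] in α , K , *-comm α 2 , E≡2K , α[C+α]≡2K²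
    where
    E²≡2α[C+α] : E * E ≡ 2 * (α * (C + α))
    E²≡2α[C+α] = *-cancelˡ-≡ _ _ 2 (trans (sym gap) (regroup α C))
      where
      regroup : ∀ α C → α * 2 * (2 * C + α * 2) ≡ 2 * (2 * (α * (C + α)))
      regroup = solve-∀

  parametrise : ∀ {C E v} → Coprime C E → C * C + 2 * (E * E) ≡ v * v →
    ∃₂ λ l m → v ≡ l * l + 2 * (m * m) × E ≡ 2 * (l * m) × (C + 2 * (m * m) ≡ l * l ⊎ C + l * l ≡ 2 * (m * m))
  parametrise {C} {E} {v} C⊥E C²+2E²≡v² with square-gap {C} {E} {v} C²+2E²≡v²
  ... | d , refl , gap with halve-square-gap {C} {E} {d} gap
  ...   | α , K , refl , refl , α[C+α]≡2K² with coprime-prime-square-factors prime[2] {x = K} α⊥C+α α[C+α]≡2K²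
    where
    α⊥C+α : Coprime α (C + α)
    α⊥C+α {g} (g∣α , g∣C+α) = coprime-*ʳ C⊥E C⊥E (g∣C , g∣E²)
      where
      g∣C : g ∣ C
      g∣C = ∣m+n∣m⇒∣n (subst (g ∣_) (+-comm C α) g∣C+α) g∣α
      g∣E² : g ∣ 2 * K * (2 * K)
      g∣E² = subst (g ∣_) (trans (cong (2 *_) α[C+α]≡2K²) (regroup K)) (∣n⇒∣m*n 2 (∣m⇒∣m*n (C + α) g∣α))
        where
        regroup : ∀ K → 2 * (2 * (K * K)) ≡ 2 * K * (2 * K)
        regroup = solve-∀
  ...     | inj₁ (s , t , α≡2s² , C+α≡t² , K≡st) =
    t , s , v≡ , cong (2 *_) (trans K≡st (*-comm s t)) , inj₁ (trans (cong (C +_) (sym α≡2s²)) C+α≡t²)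
    where
    v≡ : C + 2 * α ≡ t * t + 2 * (s * s)
    v≡ = trans (regroup C α) (cong₂ _+_ C+α≡t² α≡2s²)
      where
      regroup : ∀ C α → C + 2 * α ≡ C + α + α
      regroup = solve-∀
  ...     | inj₂ (s , t , α≡s² , C+α≡2t² , K≡st) =
    s , t , v≡ , cong (2 *_) K≡st , inj₂ (trans (cong (C +_) (sym α≡s²)) C+α≡2t²)
    where
    v≡ : C + 2 * α ≡ s * s + 2 * (t * t)
    v≡ = trans (regroup C α) (cong₂ _+_ α≡s² C+α≡2t²)
      where
      regroup : ∀ C α → C + 2 * α ≡ α + (C + α)
      regroup = solve-∀

open import Defs
open import Data.Nat using (ℕ; _+_; _*_; _<_; _%_)
open import Data.Nat.Primality using (Prime)
open import Data.Product using (∃; ∃-syntax; _×_)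
open import Data.Sum using (_⊎_)
open import Data.Integer as ℤ using (ℤ; +_; -_; ∣_∣)
open import Relation.Binary.PropositionalEquality using (_≡_)

module ClosedForm where

  import Data.Nat as ℕ
  import Data.Nat.Properties as ℕ
  open import Data.Nat.Divisibility using (_∣_; ∣m+n∣m⇒∣n; ∣n⇒∣m*n; ∣1⇒≡1)
  open import Data.Nat.Coprimality using (Coprime)
  open import Data.Integer.Properties using (pos-+)
  open import Data.Product using (_,_)
  open import Data.Sum using (inj₁; inj₂)
  open import Relation.Binary.PropositionalEquality
  open import Data.Integer.Tactic.RingSolver using (solve-∀)
  open import Data.Nat.Tactic.RingSolver using () renaming (solve-∀ to ℕ-solve-∀)
  open Composition using (∣+m-+n∣≡∣m-n∣)
  open ConjugateFactor using (Adjacent)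

  adjacent⇒coprime : ∀ {a b C E} → Adjacent (b * C) (a * E) → Coprime C E
  adjacent⇒coprime {a} {b} (inj₁ bC≡aE+1) {d} (d∣C , d∣E) =
    ∣1⇒≡1 (∣m+n∣m⇒∣n (subst (d ∣_) bC≡aE+1 (∣n⇒∣m*n b d∣C)) (∣n⇒∣m*n a d∣E))
  adjacent⇒coprime {a} {b} (inj₂ aE≡bC+1) {d} (d∣C , d∣E) =
    ∣1⇒≡1 (∣m+n∣m⇒∣n (subst (d ∣_) aE≡bC+1 (∣n⇒∣m*n a d∣E)) (∣n⇒∣m*n b d∣C))

  adjacent⇒±1 : ∀ {m n} → Adjacent m n → + m ℤ.- + n ≡ + 1 ⊎ + m ℤ.- + n ≡ - (+ 1)
  adjacent⇒±1 {n = n} (inj₁ refl) = inj₁ (trans (cong (ℤ._- + n) (pos-+ n 1)) (i+1-i≡1 (+ n)))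
    where
    i+1-i≡1 : ∀ i → i ℤ.+ + 1 ℤ.- i ≡ + 1
    i+1-i≡1 = solve-∀
  adjacent⇒±1 {m} (inj₂ refl) = inj₂ (trans (cong (ℤ._-_ (+ m)) (pos-+ m 1)) (i-[i+1]≡-1 (+ m)))
    where
    i-[i+1]≡-1 : ∀ i → i ℤ.- (i ℤ.+ + 1) ≡ - (+ 1)
    i-[i+1]≡-1 = solve-∀

  ∣m+n-n∣≡m : ∀ m n → ℕ.∣ m + n - n ∣ ≡ m
  ∣m+n-n∣≡m m n = trans (ℕ.m≤n⇒∣n-m∣≡n∸m (ℕ.m≤n+m n m)) (ℕ.m+n∸n≡m m n)

  absDiff≡ : ∀ {l m C} → C + 2 * (m * m) ≡ l * l ⊎ C + l * l ≡ 2 * (m * m) → absDiff l m ≡ C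
  absDiff≡ {l} {m} {C} (inj₁ C+2m²≡l²) = begin
    absDiff l m                   ≡⟨ ∣+m-+n∣≡∣m-n∣ (l * l) (2 * (m * m)) ⟩
    ℕ.∣ l * l - 2 * (m * m) ∣     ≡⟨ cong (λ k → ℕ.∣ k - 2 * (m * m) ∣) (sym C+2m²≡l²) ⟩
    ℕ.∣ C + 2 * (m * m) - 2 * (m * m) ∣ ≡⟨ ∣m+n-n∣≡m C _ ⟩
    C                             ∎
    where open ≡-Reasoning
  absDiff≡ {l} {m} {C} (inj₂ C+l²≡2m²) = begin
    absDiff l m                   ≡⟨ ∣+m-+n∣≡∣m-n∣ (l * l) (2 * (m * m)) ⟩
    ℕ.∣ l * l - 2 * (m * m) ∣     ≡⟨ ℕ.∣-∣-comm (l * l) _ ⟩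
    ℕ.∣ 2 * (m * m) - l * l ∣     ≡⟨ cong (λ k → ℕ.∣ k - l * l ∣) (sym C+l²≡2m²) ⟩
    ℕ.∣ C + l * l - l * l ∣       ≡⟨ ∣m+n-n∣≡m C _ ⟩
    C                             ∎
    where open ≡-Reasoning

  2alm≡aE : ∀ {a l m E} → E ≡ 2 * (l * m) → 2 * a * l * m ≡ a * E
  2alm≡aE {a} {l} {m} refl = regroup a l m
    where
    regroup : ∀ a l m → 2 * a * l * m ≡ a * (2 * (l * m))
    regroup = ℕ-solve-∀

  u≡4blm+aC : ∀ {a b u C E l m} → u ≡ a * C + 2 * (b * E) → E ≡ 2 * (l * m) → u ≡ 4 * b * l * m + a * C
  u≡4blm+aC {a} {b} {u} {C} {E} {l} {m} u≡ refl = trans u≡ (regroup a b l m C)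
    where
    regroup : ∀ a b l m C → a * C + 2 * (b * (2 * (l * m))) ≡ 4 * b * l * m + a * C
    regroup = ℕ-solve-∀

open import Data.Product using (_,_)
open import Data.Nat.Base using (>-nonZero⁻¹)
open import Data.Nat.Primality using (prime⇒nonZero)
open import Relation.Binary.PropositionalEquality using (subst; subst₂; sym; trans; cong; cong₂)
open ClosedForm
open SquareFactors using (prime-nonsquare)
open LeastSolution using (minimal-pell-solution)
open PellExistence using (pell-solvable)
open MinimalSolution using (minimal-pell-solution-factors)
open ConjugateFactor using (conjugate-factor)
open Parametrisation using (parametrise)

proposition4 : (A a b : ℕ) → Prime A → A % 8 ≡ 3 → 0 < a → 0 < b →
    A ≡ a * a + 2 * (b * b) →
    ∃[ l ] ∃[ m ]
    (((+ (b * absDiff l m)) ℤ.- (+ (2 * a * l * m)) ≡ + 1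
    ⊎ (+ (b * absDiff l m)) ℤ.- (+ (2 * a * l * m)) ≡ - (+ 1))
    × IsMinimalPellSolution A ((4 * b * l * m + a * absDiff l m) * (l * l + 2 * (m * m))))
proposition4 A a b A-prime A%8≡3 0<a 0<b A≡a²+2b²
  with pell-solvable (>-nonZero⁻¹ A {{prime⇒nonZero A-prime}}) (λ y q → prime-nonsquare A-prime q y)
... | x₀ , y₀ , 0<x₀ , pell₀
  with minimal-pell-solution {A} (0<x₀ , y₀ , pell₀)
... | x , minimal
  with minimal-pell-solution-factors A-prime A%8≡3 {x} minimal
... | u , v , u²+2≡Av² , x≡uv
  with conjugate-factor {u = u} {v} A-prime A≡a²+2b² 0<a 0<b u²+2≡Av²
... | C , E , u≡aC+2bE , C²+2E²≡v² , adjacent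
  with parametrise {C} {E} {v} (adjacent⇒coprime {a} {b} adjacent) C²+2E²≡v²
... | l , m , v≡l²+2m² , E≡2lm , C-cases = l , m , ±1 , subst (IsMinimalPellSolution A) x≡ minimal
  where
  absDiff≡C : absDiff l m ≡ C
  absDiff≡C = absDiff≡ {l} {m} C-cases
  ±1 : + (b * absDiff l m) ℤ.- + (2 * a * l * m) ≡ + 1 ⊎ + (b * absDiff l m) ℤ.- + (2 * a * l * m) ≡ - (+ 1)
  ±1 = subst₂ (λ c e → + (b * c) ℤ.- + e ≡ + 1 ⊎ + (b * c) ℤ.- + e ≡ - (+ 1))
    (sym absDiff≡C) (sym (2alm≡aE {a} E≡2lm)) (adjacent⇒±1 adjacent)
  x≡ : x ≡ (4 * b * l * m + a * absDiff l m) * (l * l + 2 * (m * m))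
  x≡ = trans x≡uv (cong₂ _*_ u≡ v≡l²+2m²)
    where
    u≡ : u ≡ 4 * b * l * m + a * absDiff l m
    u≡ = trans (u≡4blm+aC {a} {b} u≡aC+2bE E≡2lm) (cong (λ c → 4 * b * l * m + a * c) (sym absDiff≡C))
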